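{- For every value of $\rho$ (a positive integer) there exists an integer $N(\rho)\ge 2$ such that the following holds. Let $a_1<a_2<\cdots<a_d$ be positive integers with $\gcd(a_1,\ldots,a_d)=1$ and $\lceil a_1/d\rceil=\rho$, and let $F$ and $g$ be the Frobenius number and the genus of the numerical semigroup $\mathcal{S}=\{\sum_{i=1}^d\lambda_i a_i : \lambda_i\in\mathbb{N}\}$. If $a_1\ge N(\rho)$ and all prime factors of $a_1$ are greater than or equal to $\rho$, then Wilf's inequality holds: $$d\ \ge\ \frac{F+1}{F+1-g}.$$
   Context: $\mathbb{N}$ denotes the non-negative integers. Since $\gcd(a_1,\ldots,a_d)=1$, the set of gaps $\mathbb{N}\setminus\mathcal{S}$ is finite. The Frobenius number $F$ is the largest integer not belonging to $\mathcal{S}$, that is, not representable as a linear combination of $a_1,\ldots,a_d$ with coefficients in $\mathbb{N}$, and the genus is $g=|\mathbb{N}\setminus\mathcal{S}|$. When $a_1\ge 2$ one has $F+1-g=|\mathcal{S}\cap[0,F]|\ge 1$, so the fraction is well defined. -}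

module Defs where

open import Data.Nat.Base using (ℕ; zero; suc; _+_; _∸_; _*_; _≤_; _<_; s≤s; NonZero; >-nonZero)
open import Data.Nat.GCD using (gcd)
open import Data.Nat.Properties
  using (+-0-monoid; m<n⇒0<n∸m; <-≤-trans; +-comm; ≤-reflexive)
open import Data.Fin.Base using (Fin; fromℕ<)
open import Data.Fin.Properties using (injective⇒≤; fromℕ<-injective)
open import Data.Product.Base using (∃; _×_; _,_; proj₁; proj₂)
open import Data.Vec.Functional using (Vector; foldr)
open import Function.Base using (_∘_)
open import Function.Bundles using (_↔_; Inverse)
open import Function.Definitions using (Injective)
open import Level using (0ℓ)
open import Relation.Binary.PropositionalEquality using (_≡_; refl; sym; trans; cong)
open import Relation.Nullary.Negation using (contradiction)
open import Relation.Unary using (Pred; _∈_; _∉_; ∁)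
open import Algebra.Properties.Monoid.Sum +-0-monoid using (sum; sum-replicate-zero)

⟨_⟩ : ∀ {d} → Vector ℕ d → Pred ℕ 0ℓ
⟨_⟩ {d} a n = ∃ λ (c : Vector ℕ d) → n ≡ sum λ i → c i * a i

gcdAll : ∀ {d} → Vector ℕ d → ℕ
gcdAll = foldr gcd 0

-- F ranges over ℕ: only for S = ℕ is the largest integer outside S negative.
IsFrobenius : Pred ℕ 0ℓ → ℕ → Set
IsFrobenius S F = F ∉ S × (∀ n → n ∉ S → n ≤ F)

-- Any two proofs of n ∉ S are definitionally equal, because ⊥ is
-- proof-irrelevant, so ∃ (∁ S) has exactly one element for each gap of S.
HasGenus : Pred ℕ 0ℓ → ℕ → Set
HasGenus S g = Fin g ↔ ∃ (∁ S)

0∈⟨_⟩ : ∀ {d} (a : Vector ℕ d) → 0 ∈ ⟨ a ⟩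
0∈⟨_⟩ {d} a = (λ _ → 0) , sym (sum-replicate-zero d)

genus≤Frobenius : ∀ {S F g} → 0 ∈ S → IsFrobenius S F → HasGenus S g → g ≤ F
genus≤Frobenius {S} {F} {g} 0∈S (_ , F-max) genus = injective⇒≤ index-injective
  where
  gap : Fin g → ℕ
  gap = proj₁ ∘ Inverse.to genus

  gap-injective : Injective _≡_ _≡_ gap
  gap-injective {i} {j} eq = trans (sym (Inverse.strictlyInverseʳ genus i))
    (trans (cong (Inverse.from genus) (pair-≡ eq)) (Inverse.strictlyInverseʳ genus j))
    where
    pair-≡ : ∀ {x y : ∃ (∁ S)} → proj₁ x ≡ proj₁ y → x ≡ y
    pair-≡ refl = refl

  predecessor : ∀ n → n ∉ S → ∃ λ m → n ≡ suc m × m < F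
  predecessor zero    0∉S = contradiction 0∈S 0∉S
  predecessor (suc m) n∉S = m , refl , F-max (suc m) n∉S

  pred-of : ∀ i → ∃ λ m → gap i ≡ suc m × m < F
  pred-of i = predecessor (gap i) (proj₂ (Inverse.to genus i))

  index : Fin g → Fin F
  index i = fromℕ< (proj₂ (proj₂ (pred-of i)))

  index-injective : Injective _≡_ _≡_ index
  index-injective {i} {j} eq = gap-injective
    (trans (proj₁ (proj₂ (pred-of i)))
    (trans (cong suc (fromℕ<-injective _ _ _ _ eq)) (sym (proj₁ (proj₂ (pred-of j))))))

F+1∸g-nonZero : ∀ {d F g} (a : Vector ℕ d) →
                IsFrobenius ⟨ a ⟩ F → HasGenus ⟨ a ⟩ g → NonZero (F + 1 ∸ g)
F+1∸g-nonZero {F = F} a frob genus = >-nonZero (m<n⇒0<n∸m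
  (<-≤-trans (s≤s (genus≤Frobenius {⟨ a ⟩} 0∈⟨ a ⟩ frob genus)) (≤-reflexive (+-comm 1 F))))

{-# OPTIONS --safe #-}

-- Write m = a₁, c = F + 1 and T = |S ∩ [0, c)|; since m ≤ ρ d, it suffices to
-- show c ≤ d T or ρ c ≤ m T.  If elements s of S are pairwise incongruent mod m,
-- then T is at least the sum of the numbers of terms s + k m below c, and such a
-- number is at least max(m, c - s) / m as soon as s < c.  At least m - d residue
-- classes have a nonzero Apéry element that is not a generator, hence of the form
-- x + y with x ≤ y nonzero Apéry elements and x + y < c + m.
--  * If 5 d ≥ 4 m, one such x together with 0 gives 4 m T ≥ 5 c (and with no
--    such x at all, d ≥ m).
--  * Otherwise there are at least 12 ρ³ such sums when m ≥ 60 ρ³.  Either 4 ρ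
--    different x occur, each contributing c / 4 to m T, or one x occurs with 3 ρ²
--    different y.  In that case use the classes of 0, x, ..., (ρ - 1) x, which are
--    distinct because the prime factors of m are at least ρ: they contribute ρ c
--    up to an error of ρ² x, which is made up for by the remaining 2 ρ² or more
--    classes of the y, each contributing at least x / 2.
module Submission where

open import Defs
open import Data.Bool.Base using (if_then_else_; true; false)
open import Data.Fin.Base as Fin using (zero; suc)
open import Data.Fin.Properties using (any?)
open import Data.List.Base using (List; []; _∷_; _++_; map; length; filter; upTo; applyUpTo; tabulate)
open import Data.List.Properties
  using (length-map; length-upTo; length-applyUpTo; length-tabulate; filter-all; filter-accept; filter-reject; map-++)
open import Data.List.Relation.Unary.All as All using (All; []; _∷_)
import Data.List.Relation.Unary.All.Properties as All
open import Data.List.Relation.Unary.AllPairs as AllPairs using (AllPairs; []; _∷_)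
import Data.List.Relation.Unary.AllPairs.Properties as AllPairs
open import Data.List.Relation.Unary.Unique.Propositional.Properties using (upTo⁺)
open import Data.Nat.Base
  using (ℕ; zero; suc; _+_; _∸_; _*_; _%_; _≤_; _<_; z≤n; s≤s; NonZero; >-nonZero; >-nonZero⁻¹; ≢-nonZero⁻¹)
open import Data.Nat.Coprimality using (Coprime; coprime-divisor)
open import Data.Nat.Divisibility using (_∣_; divides; ∣-trans; ∣⇒≤; m∣m*n)
open import Data.Nat.DivMod renaming (_/_ to infixl 7 _÷_)
open import Data.Nat.Induction using (<-rec)
open import Data.Nat.ListAction using (sum)
open import Data.Nat.ListAction.Properties using (sum-++)
open import Data.Nat.Primality using (Prime)
open import Data.Nat.Primality.Factorisation using (factorise)
open import Data.Nat.Properties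
open import Data.Nat.Tactic.RingSolver using (solve-∀)
open import Data.Product.Base using (∃; ∃₂; _×_; _,_; proj₁; proj₂)
open import Data.Sum.Base as Sum using (_⊎_; inj₁; inj₂)
open import Data.Vec.Functional using (Vector) renaming (_∷_ to _∷ᶠ_)
open import Function.Base using (_∘_; _on_; id)
open import Function.Bundles using (Inverse)
open import Level using (0ℓ)
open import Relation.Binary.Core using (Rel; _Preserves_⟶_)
open import Relation.Binary.PropositionalEquality
open import Relation.Nullary using (Dec; yes; no; does; ¬_; ¬?; contradiction; _×-dec_)
open import Relation.Nullary.Decidable using (decidable-stable)
open import Relation.Unary using (Decidable; _∈_; _∉_; ∁)
open import Relation.Unary.Properties using (U?)

private
  variable
    A B : Set
    P Q S : ℕ → Set
    k : ℕ

-- Counting the elements of a decidable set below a bound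

indicator : {X : Set} → Dec X → ℕ
indicator X? = if does X? then 1 else 0

count : Decidable P → ℕ → ℕ
count P? zero    = 0
count P? (suc n) = indicator (P? n) + count P? n

count-mono-≤ : (P? : Decidable P) → ∀ {m n} → m ≤ n → count P? m ≤ count P? n
count-mono-≤ P? {m} {zero}  z≤n = ≤-refl
count-mono-≤ P? {m} {suc n} m≤1+n with m≤n⇒m<n∨m≡n m≤1+n
... | inj₂ refl      = ≤-refl
... | inj₁ (s≤s m≤n) = ≤-trans (count-mono-≤ P? m≤n) (m≤n+m _ (indicator (P? n)))

count-mono-< : (P? : Decidable P) → ∀ {k n} → P k → k < n → count P? k < count P? n
count-mono-< P? {k} Pk k<n with count-mono-≤ P? k<n
... | le with P? k
...   | yes _  = le
...   | no ¬Pk = contradiction Pk ¬Pk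

count-≤ : (P? : Decidable P) → ∀ n → count P? n ≤ n
count-≤ P? zero = z≤n
count-≤ P? (suc n) with P? n
... | yes _ = s≤s (count-≤ P? n)
... | no  _ = m≤n⇒m≤1+n (count-≤ P? n)

count-disjoint : (P? : Decidable P) (Q? : Decidable Q) (S? : Decidable S) →
                 (∀ {j} → Q j → P j) → (∀ {j} → S j → P j) → (∀ {j} → Q j → ¬ S j) →
                 ∀ n → count Q? n + count S? n ≤ count P? n
count-disjoint P? Q? S? Q⇒P S⇒P disj zero    = z≤n
count-disjoint P? Q? S? Q⇒P S⇒P disj (suc n) = begin
  (indicator (Q? n) + count Q? n) + (indicator (S? n) + count S? n)
    ≡⟨ interchange (indicator (Q? n)) (count Q? n) (indicator (S? n)) (count S? n) ⟩
  (indicator (Q? n) + indicator (S? n)) + (count Q? n + count S? n)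
    ≤⟨ +-mono-≤ pointwise (count-disjoint P? Q? S? Q⇒P S⇒P disj n) ⟩
  indicator (P? n) + count P? n ∎
  where
  open ≤-Reasoning
  interchange : ∀ a b c d → (a + b) + (c + d) ≡ (a + c) + (b + d)
  interchange = solve-∀
  pointwise : indicator (Q? n) + indicator (S? n) ≤ indicator (P? n)
  pointwise with Q? n | S? n | P? n
  ... | yes q | yes s | _     = contradiction s (disj q)
  ... | yes q | no _  | yes _ = ≤-refl
  ... | yes q | no _  | no ¬p = contradiction (Q⇒P q) ¬p
  ... | no _  | yes s | yes _ = ≤-refl
  ... | no _  | yes s | no ¬p = contradiction (S⇒P s) ¬p
  ... | no _  | no _  | _     = z≤n

-- Induction on the list: by disjointness the later sets lie in P without the first one, so each
-- step passes to this smaller set.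
count-family : {C : A → ℕ → Set} (C? : ∀ s → Decidable (C s)) (P? : Decidable P) →
               ∀ n {L} → AllPairs (λ s t → ∀ j → C s j → ¬ C t j) L →
               All (λ s → ∀ j → C s j → P j) L →
               sum (map (λ s → count (C? s) n) L) ≤ count P? n
count-family C? P? n []           []          = z≤n
count-family C? P? n {s ∷ _} (disj ∷ disjs) (C⇒P ∷ Cs⇒P) = ≤-trans
  (+-monoʳ-≤ (count (C? s) n)
    (count-family C? P∖C? n disjs
      (All.zipWith (λ (f , g) j c → f j c , λ c′ → g j c′ c) (Cs⇒P , disj))))
  (count-disjoint P? (C? s) P∖C? (C⇒P _) proj₁ (λ c (_ , ¬c) → ¬c c) n)
  where
  P∖C? : Decidable _
  P∖C? j = P? j ×-dec ¬? (C? s j)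

-- Sums, selections and the pigeonhole principle for lists

sum-bound : (f : A → ℕ) (b k e : ℕ) → ∀ {L} → All (λ s → b ≤ f s * k + e) L →
            length L * b ≤ sum (map f L) * k + length L * e
sum-bound f b k e []                   = z≤n
sum-bound f b k e {s ∷ L} (le ∷ les) = begin
  b + length L * b
    ≤⟨ +-mono-≤ le (sum-bound f b k e les) ⟩
  (f s * k + e) + (sum (map f L) * k + length L * e)
    ≡⟨ regroup (f s) k e (sum (map f L)) (length L) ⟩
  (f s + sum (map f L)) * k + (e + length L * e) ∎
  where
  open ≤-Reasoning
  regroup : ∀ a k e σ l → (a * k + e) + (σ * k + l * e) ≡ (a + σ) * k + (e + l * e)
  regroup = solve-∀

-- Chooses preimages entry by entry. The equation `map g L′ ≡ L` carries lengths and pairwise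
-- relations over to them.
lift-All : {X : A → Set} {Y : B → Set} (g : B → A) →
           (∀ {a} → X a → ∃ λ b → Y b × g b ≡ a) →
           ∀ {L} → All X L → ∃ λ L′ → All Y L′ × map g L′ ≡ L
lift-All g lift []       = [] , [] , refl
lift-All g lift (x ∷ xs) with lift x | lift-All g lift xs
... | b , y , refl | bs , ys , refl = b ∷ bs , y ∷ ys , refl

-- R forces different values of h, so each value in `G` is taken by at most one entry and costs at
-- most one deletion.
avoid : {R : Rel A 0ℓ} {X : A → Set} (h : A → ℕ) → (∀ {a b} → R a b → h a ≢ h b) →
        ∀ G {L} → AllPairs R L → All X L →
        ∃ λ L′ → AllPairs R L′ × All X L′ × All (λ a → All (h a ≢_) G) L′ ×
                 length L ≤ length L′ + length G
avoid h R⇒≢ [] {L} Rs Xs = L , Rs , Xs , All.universal (λ _ → []) L , m≤m+n _ 0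
avoid {R = R} h R⇒≢ (g ∷ G) Rs Xs with avoid h R⇒≢ G Rs Xs
... | L₁ , Rs₁ , Xs₁ , ∉G , len =
  filter h≢g? L₁ , AllPairs.filter⁺ h≢g? Rs₁ , All.filter⁺ h≢g? Xs₁ ,
  All.zipWith (λ (p , ps) → p ∷ ps) (All.all-filter h≢g? L₁ , All.filter⁺ h≢g? ∉G) ,
  ≤-trans len (≤-trans (+-monoˡ-≤ (length G) (length-remove Rs₁))
    (≤-reflexive (sym (+-suc _ (length G)))))
  where
  h≢g? : Decidable _
  h≢g? a = ¬? (h a ≟ g)
  length-remove : ∀ {L} → AllPairs R L → length L ≤ suc (length (filter h≢g? L))
  length-remove [] = z≤n
  length-remove {a ∷ L} (r ∷ rs) with h a ≟ g
  ... | yes ha≡g = s≤s (≤-reflexive (cong length (sym (trans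
                     (filter-reject h≢g? (λ ha≢g → ha≢g ha≡g))
                     (filter-all h≢g? (All.map (λ p hb≡g → R⇒≢ p (trans ha≡g (sym hb≡g))) r))))))
  ... | no ha≢g  = s≤s (subst (λ l → length L ≤ length l)
                     (sym (filter-accept h≢g? ha≢g)) (length-remove rs))

length-filter-¬ : {X : A → Set} (X? : Decidable X) → ∀ L →
                  length L ≡ length (filter X? L) + length (filter (¬? ∘ X?) L)
length-filter-¬ X? [] = refl
length-filter-¬ X? (a ∷ L) with does (X? a)
... | true  = cong suc (length-filter-¬ X? L)
... | false = trans (cong suc (length-filter-¬ X? L)) (sym (+-suc _ _))

-- Greedy choice: if the fibre of the head has k entries, it is the second outcome. Otherwise
-- deleting it removes fewer than k entries, which leaves at least n k for the recursion.
pigeonhole : {R : Rel A 0ℓ} {X : A → Set} (f : A → ℕ) → ∀ n k {L} →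
             AllPairs R L → All X L → 0 < k → n * k ≤ length L →
             (∃ λ L′ → AllPairs (_≢_ on f) L′ × All X L′ × length L′ ≡ n) ⊎
             (∃₂ λ v L′ → AllPairs R L′ × All X L′ × All (λ a → f a ≡ v) L′ × k ≤ length L′)
pigeonhole f zero k Rs Xs 0<k nk≤L = inj₁ ([] , [] , [] , refl)
pigeonhole f (suc n) k {[]} Rs Xs 0<k nk≤L =
  contradiction (≤-trans (m≤m+n k (n * k)) nk≤L) (<⇒≱ 0<k)
pigeonhole {X = X} f (suc n) k {a ∷ L} Rs (x ∷ Xs) 0<k nk≤L
  with k ≤? length (filter (λ b → f b ≟ f a) (a ∷ L))
... | yes k≤ = inj₂ (f a , filter same? (a ∷ L) , AllPairs.filter⁺ same? Rs ,
                     All.filter⁺ same? (x ∷ Xs) , All.all-filter same? (a ∷ L) , k≤)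
  where
  same? : Decidable _
  same? b = f b ≟ f a
... | no k≰ = Sum.map (λ (L′ , Rs′ , Xs′ , len) →
      a ∷ L′ , All.map (≢-sym ∘ proj₂) Xs′ ∷ Rs′ , x ∷ All.map proj₁ Xs′ , cong suc len)
    (λ (v , L′ , Rs′ , Xs′ , fibre) → v , L′ , Rs′ , All.map proj₁ Xs′ , fibre)
    -- Adding `f b ≢ f a` to X separates the head from the distinct entries that the recursion
    -- returns.
    (pigeonhole {X = λ b → X b × f b ≢ f a} f n k
      (AllPairs.filter⁺ (¬? ∘ same?) Rs)
      (All.zip (All.filter⁺ (¬? ∘ same?) (x ∷ Xs) , All.all-filter (¬? ∘ same?) (a ∷ L)))
      0<k rest)
  where
  same? : Decidable _
  same? b = f b ≟ f a
  rest : n * k ≤ length (filter (¬? ∘ same?) (a ∷ L))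
  rest = +-cancelˡ-≤ k _ _ (≤-trans nk≤L
    (≤-trans (≤-reflexive (length-filter-¬ same? (a ∷ L))) (+-monoˡ-≤ _ (<⇒≤ (≰⇒> k≰)))))

-- Residue classes and arithmetic progressions modulo m

module _ (m : ℕ) .{{_ : NonZero m}} where

  Incongruent : Rel ℕ 0ℓ
  Incongruent s t = s % m ≢ t % m

  %-≡⇒+* : ∀ {s t} → s % m ≡ t % m → s ≤ t → ∃ λ k → t ≡ s + k * m
  %-≡⇒+* {s} {t} eq s≤t = t ÷ m ∸ s ÷ m , (begin
    t                                         ≡⟨ m≡m%n+[m/n]*n t m ⟩
    t % m + t ÷ m * m                         ≡⟨ cong₂ (λ r q → r + q * m) (sym eq) (sym (m+[n∸m]≡n (/-monoˡ-≤ m s≤t))) ⟩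
    s % m + (s ÷ m + (t ÷ m ∸ s ÷ m)) * m     ≡⟨ regroup (s % m) (s ÷ m) (t ÷ m ∸ s ÷ m) m ⟩
    (s % m + s ÷ m * m) + (t ÷ m ∸ s ÷ m) * m ≡⟨ cong (_+ (t ÷ m ∸ s ÷ m) * m) (sym (m≡m%n+[m/n]*n s m)) ⟩
    s + (t ÷ m ∸ s ÷ m) * m                   ∎)
    where
    open ≡-Reasoning
    regroup : ∀ r q k m → r + (q + k) * m ≡ (r + q * m) + k * m
    regroup = solve-∀

  +-cong-% : ∀ x {y z} → y % m ≡ z % m → (x + y) % m ≡ (x + z) % m
  +-cong-% x {y} {z} eq = trans (%-distribˡ-+ x y m)
    (trans (cong (λ r → (x % m + r) % m) eq) (sym (%-distribˡ-+ x z m)))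

  -- If i x and j x are congruent, m divides (j - i) x. A common prime factor of m and j - i would
  -- be at least ρ but at most j - i < ρ, so m is coprime to j - i and divides x, contrary to
  -- `x % m ≢ 0`.
  multiples-incongruent : ∀ {ρ x} → (∀ p → Prime p → p ∣ m → ρ ≤ p) → x % m ≢ 0 →
                          ∀ {i j} → i < j → j < ρ → Incongruent (i * x) (j * x)
  multiples-incongruent {ρ} {x} rough x≢0 {i} {j} i<j j<ρ eq
    with %-≡⇒+* eq (*-monoˡ-≤ x (<⇒≤ i<j))
  ... | k , jx≡ix+km = x≢0 (m∣x⇒x%m≡0 (coprime-divisor coprime (divides k [j∸i]x≡km)))
    where
    open ≡-Reasoning
    [j∸i]x≡km : (j ∸ i) * x ≡ k * m
    [j∸i]x≡km = begin
      (j ∸ i) * x             ≡⟨ *-distribʳ-∸ x j i ⟩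
      j * x ∸ i * x           ≡⟨ cong (_∸ i * x) jx≡ix+km ⟩
      i * x + k * m ∸ i * x   ≡⟨ m+n∸m≡n (i * x) (k * m) ⟩
      k * m                   ∎
    m∣x⇒x%m≡0 : m ∣ x → x % m ≡ 0
    m∣x⇒x%m≡0 (divides q x≡qm) = trans (cong (_% m) x≡qm) (m*n%n≡0 q m)
    instance
      j∸i-nonZero : NonZero (j ∸ i)
      j∸i-nonZero = >-nonZero (m<n⇒0<n∸m i<j)
    coprime : Coprime m (j ∸ i)
    coprime {zero} (divides q m≡q0 , _) =
      contradiction (trans m≡q0 (*-zeroʳ q)) (≢-nonZero⁻¹ m)
    coprime {suc e} (e∣m , e∣j∸i) with factorise (suc e)
    ... | record { factors = [] ; isFactorisation = eq } = eq
    ... | record { factors = p ∷ ps ; isFactorisation = eq ; factorsPrime = p-prime ∷ _ } =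
      contradiction (rough p p-prime (∣-trans p∣e e∣m))
        (<⇒≱ (≤-<-trans (≤-trans (∣⇒≤ (∣-trans p∣e e∣j∸i)) (m∸n≤m j i)) j<ρ))
      where
      p∣e : p ∣ suc e
      p∣e = subst (p ∣_) (sym eq) (m∣m*n _)

  -- The progression s, s + m, s + 2 m, ... as a decidable condition on j.
  InClass : ℕ → ℕ → Set
  InClass s j = s ≤ j × j % m ≡ s % m

  inClass? : ∀ s → Decidable (InClass s)
  inClass? s j = s ≤? j ×-dec j % m ≟ s % m

  hits : ℕ → ℕ → ℕ
  hits n s = count (inClass? s) n

  hits-progression : ∀ s k → k < hits (suc (s + k * m)) s
  hits-progression s zero = ≤-<-trans z≤n
    (count-mono-< (inClass? s) (m≤m+n s 0 , cong (_% m) (+-identityʳ s)) ≤-refl)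
  hits-progression s (suc k) = ≤-<-trans
    (≤-trans (hits-progression s k) (count-mono-≤ (inClass? s)
      (≤-trans (≤-reflexive (sym (+-suc s (k * m)))) (+-monoʳ-≤ s (+-monoˡ-≤ (k * m) (>-nonZero⁻¹ m))))))
    (count-mono-< (inClass? s) (m≤m+n s _ , [m+kn]%n≡m%n s (suc k) m) ≤-refl)

  -- The quotient is the largest k with s + k m < n, and the terms with index 0 to k all lie below
  -- n.
  hits>quotient : ∀ {n s} → s < n → (n ∸ suc s) ÷ m < hits n s
  hits>quotient {n} {s} s<n = <-≤-trans (hits-progression s ((n ∸ suc s) ÷ m))
    (count-mono-≤ (inClass? s) (begin
      suc s + (n ∸ suc s) ÷ m * m ≤⟨ +-monoʳ-≤ (suc s) (m/n*n≤m (n ∸ suc s) m) ⟩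
      suc s + (n ∸ suc s)         ≡⟨ m+[n∸m]≡n s<n ⟩
      n                           ∎))
    where open ≤-Reasoning

  hits-≥1 : ∀ {n s} → s < n → m ≤ hits n s * m
  hits-≥1 {n} {s} s<n = ≤-trans (≤-reflexive (sym (*-identityˡ m)))
    (*-monoˡ-≤ m (≤-<-trans z≤n (hits>quotient s<n)))

  -- For s < n the remainder of n - s - 1 is at most m - 1, so rounding up absorbs it. With s on the
  -- right the bound also holds when s ≥ n.
  hits-≥ : ∀ n s → n ≤ hits n s * m + s
  hits-≥ n s with s <? n
  ... | no s≮n  = ≤-trans (≮⇒≥ s≮n) (m≤n+m s _)
  ... | yes s<n = begin
    n                             ≡⟨ sym (m+[n∸m]≡n s<n) ⟩
    suc s + r                     ≡⟨ cong (suc s +_) (m≡m%n+[m/n]*n r m) ⟩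
    suc s + (r % m + r ÷ m * m)   ≡⟨ regroup s (r % m) (r ÷ m * m) ⟩
    suc (r % m) + r ÷ m * m + s   ≤⟨ +-monoˡ-≤ s (+-monoˡ-≤ (r ÷ m * m) (m%n<n r m)) ⟩
    suc (r ÷ m) * m + s           ≤⟨ +-monoˡ-≤ s (*-monoˡ-≤ m (hits>quotient s<n)) ⟩
    hits n s * m + s              ∎
    where
    open ≤-Reasoning
    r = n ∸ suc s
    regroup : ∀ s a b → suc s + (a + b) ≡ suc a + b + s
    regroup = solve-∀

  -- Progressions in different classes are disjoint, and P contains each of them because it is
  -- closed under adding m.
  hits-sum : (P? : Decidable P) → (∀ {n} → P n → ∀ k → P (n + k * m)) →
             ∀ n {L} → AllPairs Incongruent L → All P L →
             sum (map (hits n) L) ≤ count P? n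
  hits-sum {P} P? P-+* n distinct Ps = count-family inClass? P? n
    (AllPairs.map (λ s≢t _ (_ , j≡s) (_ , j≡t) → s≢t (trans (sym j≡s) j≡t)) distinct)
    (All.map (λ Ps _ → member Ps) Ps)
    where
    member : ∀ {s j} → P s → InClass s j → P j
    member Ps (s≤j , j≡s) with %-≡⇒+* (sym j≡s) s≤j
    ... | k , refl = P-+* Ps k

-- G lists the generators other than the multiplicity m, possibly redundantly.
module _ (P? : Decidable P) (P-0 : P 0) (P-+ : ∀ {x y} → P x → P y → P (x + y))
         (m : ℕ) .{{_ : NonZero m}} (P-m : P m) (m-least : ∀ {n} → P n → n ≢ 0 → m ≤ n)
         (c : ℕ) (P-≥ : ∀ {n} → c ≤ n → P n)
         (G : List ℕ)
         (decompose : ∀ {w} → P w → w ≢ 0 → All (w ≢_) (m ∷ G) →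
                      ∃₂ λ x y → w ≡ x + y × (P x × x ≢ 0) × (P y × y ≢ 0))
         where

  -- The Apéry set of P with respect to m

  P-* : ∀ {x} → P x → ∀ k → P (k * x)
  P-* Px zero    = P-0
  P-* Px (suc k) = P-+ Px (P-* Px k)

  P-+* : ∀ {n} → P n → ∀ k → P (n + k * m)
  P-+* Pn k = P-+ Pn (P-* P-m k)

  -- The second condition says that s - m is not in P. Quantifying over n avoids `s ∸ m`, which for
  -- s < m would be 0, an element of P.
  Apéry : ℕ → Set
  Apéry s = P s × (∀ {n} → s ≡ m + n → ¬ P n)

  Apéry-0 : Apéry 0
  Apéry-0 = P-0 , λ 0≡m+n → contradiction (m+n≡0⇒m≡0 m (sym 0≡m+n)) (≢-nonZero⁻¹ m)

  Apéry-exists : ∀ n → P n → ∃ λ s → Apéry s × s % m ≡ n % m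
  Apéry-exists = <-rec _ step
    where
    step : ∀ n → (∀ {k} → k < n → P k → ∃ λ s → Apéry s × s % m ≡ k % m) →
           P n → ∃ λ s → Apéry s × s % m ≡ n % m
    step n rec Pn with m ≤? n
    ... | no m≰n = n , (Pn , λ { {k} refl _ → m≰n (m≤m+n m k) }) , refl
    ... | yes m≤n with P? (n ∸ m)
    ...   | no ¬P = n , (Pn , λ { {k} refl Pk → ¬P (subst P (sym (m+n∸m≡n m k)) Pk) }) , refl
    ...   | yes P′ with rec (∸-monoʳ-< (>-nonZero⁻¹ m) m≤n) P′
    ...     | s , ap , eq = s , ap , trans eq (m≤n⇒[n∸m]%m≡n%m m≤n)

  -- If s ≥ c + m, then s - m ≥ c lies in P.
  Apéry-< : ∀ {s} → Apéry s → s < c + m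
  Apéry-< {s} (_ , minimal) = ≰⇒> λ c+m≤s →
    minimal (sym (m+[n∸m]≡n (≤-trans (m≤n+m m c) c+m≤s)))
            (P-≥ (≤-trans (≤-reflexive (sym (m+n∸n≡m c m))) (∸-monoˡ-≤ m c+m≤s)))

  -- If t = s + (k + 1) m, then t - m = s + k m lies in P.
  Apéry-unique-≤ : ∀ {s t} → Apéry s → Apéry t → s % m ≡ t % m → s ≤ t → s ≡ t
  Apéry-unique-≤ {s} (Ps , _) (_ , minimal) eq s≤t with %-≡⇒+* m eq s≤t
  ... | zero  , t≡s+0 = sym (trans t≡s+0 (+-identityʳ s))
  ... | suc k , t≡    = contradiction (P-+* Ps k) (minimal (trans t≡ (swap s m (k * m))))
    where
    swap : ∀ a b c → a + (b + c) ≡ b + (a + c)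
    swap = solve-∀

  Apéry-unique : ∀ {s t} → Apéry s → Apéry t → s % m ≡ t % m → s ≡ t
  Apéry-unique {s} {t} ap-s ap-t eq with ≤-total s t
  ... | inj₁ s≤t = Apéry-unique-≤ ap-s ap-t eq s≤t
  ... | inj₂ t≤s = sym (Apéry-unique-≤ ap-t ap-s (sym eq) t≤s)

  -- If x - m were in P, then so would be (x - m) + y = (x + y) - m.
  Apéry-summand : ∀ {x y} → P x → P y → Apéry (x + y) → Apéry x
  Apéry-summand {x} {y} Px Py (_ , minimal) = Px , λ { {n} x≡m+n Pn →
    minimal (trans (cong (_+ y) x≡m+n) (+-assoc m n y)) (P-+ Pn Py) }

  -- Apéry elements as sums of two nonzero Apéry elements

  record Split (p : ℕ × ℕ) : Set where
    constructor split
    x = proj₁ p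
    y = proj₂ p
    field
      x-Apéry : Apéry x
      y-Apéry : Apéry y
      x≢0     : x ≢ 0
      x≤y     : x ≤ y
      x+y<c+m : x + y < c + m

    m≤x : m ≤ x
    m≤x = m-least (proj₁ x-Apéry) x≢0

    x%m≢0 : x % m ≢ 0
    x%m≢0 x≡0 = x≢0 (Apéry-unique x-Apéry Apéry-0 (trans x≡0 (sym (m*n%n≡0 0 m))))

    y<c : y < c
    y<c = +-cancelˡ-< m y c (≤-<-trans (+-monoˡ-≤ y m≤x) (<-≤-trans x+y<c+m (≤-reflexive (+-comm c m))))

    2x≤c+m : 2 * x ≤ c + m
    2x≤c+m = ≤-trans (≤-reflexive (cong (x +_) (+-identityʳ x))) (≤-trans (+-monoʳ-≤ x x≤y) (<⇒≤ x+y<c+m))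

    -- `hits` times m is at least c - y and, as y < c, at least m. The average of the two is (c + m
    -- - y) / 2, which exceeds x / 2.
    hits-y : x ≤ hits m c y * (2 * m)
    hits-y = +-cancelʳ-≤ y x _ (begin
      x + y                                 ≤⟨ <⇒≤ x+y<c+m ⟩
      c + m                                 ≤⟨ +-mono-≤ (hits-≥ m c y) (hits-≥1 m y<c) ⟩
      hits m c y * m + y + hits m c y * m   ≡⟨ double (hits m c y) m y ⟩
      hits m c y * (2 * m) + y              ∎)
      where
      open ≤-Reasoning
      double : ∀ h m y → h * m + y + h * m ≡ h * (2 * m) + y
      double = solve-∀

    -- The same averaging gives (c + m - x) / 2, and x ≤ (c + m) / 2 turns this into (c + m) / 4.
    hits-x : c ≤ hits m c x * (4 * m)
    hits-x = +-cancelʳ-≤ (c + m + m) c _ (begin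
      c + (c + m + m)                                     ≡⟨ regroup c m ⟩
      2 * (c + m)                                         ≤⟨ *-monoʳ-≤ 2
        (+-mono-≤ (hits-≥ m c x) (hits-≥1 m (≤-<-trans x≤y y<c))) ⟩
      2 * (hits m c x * m + x + hits m c x * m)           ≡⟨ double (hits m c x) m x ⟩
      hits m c x * (4 * m) + 2 * x                        ≤⟨ +-monoʳ-≤ (hits m c x * (4 * m)) 2x≤c+m ⟩
      hits m c x * (4 * m) + (c + m)                      ≤⟨ +-monoʳ-≤ (hits m c x * (4 * m)) (m≤m+n (c + m) m) ⟩
      hits m c x * (4 * m) + (c + m + m)                  ∎)
      where
      open ≤-Reasoning
      regroup : ∀ c m → c + (c + m + m) ≡ 2 * (c + m)
      regroup = solve-∀
      double : ∀ h m x → 2 * (h * m + x + h * m) ≡ h * (4 * m) + 2 * x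
      double = solve-∀

  Apéry-split : ∀ {w} → Apéry w → All (w ≢_) (0 ∷ G) → ∃ λ p → Split p × proj₁ p + proj₂ p ≡ w
  Apéry-split {w} ap@(Pw , minimal) (w≢0 ∷ w∉G)
    -- An Apéry element differs from m, because m - m = 0 lies in P.
    with decompose Pw w≢0 ((λ w≡m → minimal (trans w≡m (sym (+-identityʳ m))) P-0) ∷ w∉G)
  ... | x , y , refl , (Px , x≢0) , (Py , y≢0) with ≤-total x y
  ...   | inj₁ x≤y = (x , y) , split (Apéry-summand Px Py ap)
                                     (Apéry-summand Py Px (subst Apéry (+-comm x y) ap))
                                     x≢0 x≤y (Apéry-< ap) , refl
  ...   | inj₂ y≤x = (y , x) , split (Apéry-summand Py Px (subst Apéry (+-comm x y) ap))
                                     (Apéry-summand Px Py ap)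
                                     y≢0 y≤x (subst (_< c + m) (+-comm x y) (Apéry-< ap)) , +-comm y x

  _≁_ : Rel (ℕ × ℕ) 0ℓ
  _≁_ = Incongruent m on λ (x , y) → x + y

  -- Choose one Apéry element per residue class. Discarding 0 and the entries of `G` costs at most 1
  -- + `length G` of these m elements, and the others split.
  splits : ∃ λ L → AllPairs _≁_ L × All Split L × m ≤ length L + suc (length G)
  splits with lift-All {Y = Apéry} (_% m) residue (All.all-upTo m)
    where
    residue : ∀ {r} → r < m → ∃ λ s → Apéry s × s % m ≡ r
    -- r + c m is in the class of r and is at least c, hence lies in P.
    residue {r} r<m with Apéry-exists (r + c * m) (P-≥ (≤-trans (m≤m*n c m) (m≤n+m (c * m) r)))
    ... | s , ap , eq = s , ap , trans eq (trans ([m+kn]%n≡m%n r c m) (m<n⇒m%n≡m r<m))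
  ... | Ws , aps , residues
    with avoid id (λ a≢b a≡b → a≢b (cong (_% m) a≡b)) (0 ∷ G)
           (AllPairs.map⁻ (subst (AllPairs _≢_) (sym residues) (upTo⁺ m))) aps
  ...   | Ws′ , distinct , aps′ , ∉G , len
    with lift-All {Y = Split} (λ (x , y) → x + y) (λ (ap , w∉G) → Apéry-split ap w∉G) (All.zip (aps′ , ∉G))
  ...     | L , Splits , refl = L , AllPairs.map⁻ distinct , Splits , (begin
    m                                     ≡⟨ length-upTo m ⟨
    length (upTo m)                       ≡⟨ cong length residues ⟨
    length (map (_% m) Ws)                ≡⟨ length-map (_% m) Ws ⟩
    length Ws                             ≤⟨ len ⟩
    length (map _ L) + suc (length G)     ≡⟨ cong (_+ suc (length G)) (length-map _ L) ⟩
    length L + suc (length G)             ∎)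
    where open ≤-Reasoning

  -- Lower bounds for the number of elements below c

  d : ℕ
  -- The generators are m and the entries of `G`.
  d = suc (length G)

  T : ℕ
  T = count P? c

  hits-sum-≤ : ∀ {L} → AllPairs (Incongruent m) L → All P L → sum (map (hits m c) L) ≤ T
  hits-sum-≤ = hits-sum m P? P-+* c

  T-bound-trivial : c ≤ T * m
  T-bound-trivial = begin
    c                    ≤⟨ hits-≥ m c 0 ⟩
    hits m c 0 * m + 0   ≡⟨ regroup (hits m c 0) m ⟩
    (hits m c 0 + 0) * m ≤⟨ *-monoˡ-≤ m (hits-sum-≤ ([] ∷ []) (P-0 ∷ [])) ⟩
    T * m                ∎
    where
    open ≤-Reasoning
    regroup : ∀ h m → h * m + 0 ≡ (h + 0) * m
    regroup = solve-∀

  T-bound-split : ∀ {p} → Split p → 5 * c ≤ T * (4 * m)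
  T-bound-split {x , y} s = begin
    5 * c                                              ≡⟨ five c ⟩
    4 * c + c                                          ≤⟨ +-mono-≤ (*-monoʳ-≤ 4 (hits-≥ m c 0)) hits-x ⟩
    4 * (hits m c 0 * m + 0) + hits m c x * (4 * m)    ≡⟨ regroup (hits m c 0) (hits m c x) m ⟩
    (hits m c 0 + (hits m c x + 0)) * (4 * m)          ≤⟨ *-monoˡ-≤ (4 * m)
      (hits-sum-≤ ((0≁x ∷ []) ∷ [] ∷ []) (P-0 ∷ proj₁ x-Apéry ∷ [])) ⟩
    T * (4 * m)                                        ∎
    where
    open ≤-Reasoning
    open Split s hiding (x; y)
    0≁x : Incongruent m 0 x
    0≁x eq = x%m≢0 (trans (sym eq) (m*n%n≡0 0 m))
    five : ∀ c → 5 * c ≡ 4 * c + c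
    five = solve-∀
    regroup : ∀ h k m → 4 * (h * m + 0) + k * (4 * m) ≡ (h + (k + 0)) * (4 * m)
    regroup = solve-∀

  -- Distinct Apéry elements are incongruent, so the contributions add up to 4 ρ times c / (4 m).
  T-bound-summands : ∀ ρ {L} → AllPairs (_≢_ on proj₁) L → All Split L → length L ≡ 4 * ρ →
                     ρ * c ≤ T * m
  T-bound-summands ρ {L} distinct Splits len = *-cancelˡ-≤ 4 (begin
    4 * (ρ * c)                                         ≡⟨ sym (*-assoc 4 ρ c) ⟩
    4 * ρ * c                                           ≡⟨ cong (_* c) (sym (trans (length-map proj₁ L) len)) ⟩
    length xs * c                                       ≤⟨ sum-bound (hits m c) c (4 * m) 0 {xs}
      (All.map⁺ (All.map (λ s → ≤-trans (Split.hits-x s) (m≤m+n _ 0)) Splits)) ⟩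
    sum (map (hits m c) xs) * (4 * m) + length xs * 0   ≡⟨ cong (sum (map (hits m c) xs) * (4 * m) +_) (*-zeroʳ (length xs)) ⟩
    sum (map (hits m c) xs) * (4 * m) + 0               ≡⟨ +-identityʳ _ ⟩
    sum (map (hits m c) xs) * (4 * m)                   ≤⟨ *-monoˡ-≤ (4 * m)
      (hits-sum-≤ (AllPairs.map⁺ (incongruent distinct Splits)) (All.map⁺ (All.map (proj₁ ∘ Split.x-Apéry) Splits))) ⟩
    T * (4 * m)                                         ≡⟨ regroup T m ⟩
    4 * (T * m)                                         ∎)
    where
    open ≤-Reasoning
    xs = map proj₁ L
    incongruent : ∀ {L} → AllPairs (_≢_ on proj₁) L → All Split L → AllPairs (Incongruent m on proj₁) L
    incongruent [] [] = []
    incongruent (r ∷ rs) (s ∷ ss) =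
      All.zipWith (λ (x≢x′ , s′) → x≢x′ ∘ Apéry-unique (Split.x-Apéry s) (Split.x-Apéry s′)) (r , ss)
      ∷ incongruent rs ss
    regroup : ∀ t m → t * (4 * m) ≡ 4 * (t * m)
    regroup = solve-∀

  -- With x = v fixed, incongruent sums v + y have incongruent y. Their progressions are combined
  -- with those of 0, v, ..., (ρ - 1) v.
  T-bound-fibre : ∀ ρ → (∀ p → Prime p → p ∣ m → ρ ≤ p) → 0 < ρ → ∀ {v L} →
                  AllPairs _≁_ L → All Split L → All (λ p → proj₁ p ≡ v) L →
                  3 * (ρ * ρ) ≤ length L → ρ * c ≤ T * m
  -- As ρ > 0, the list is not empty; its head shows that v is a nonzero Apéry element.
  T-bound-fibre ρ rough 0<ρ {v} {[]} _ _ _ 3ρ²≤0 =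
    contradiction (≤-trans (*-monoʳ-≤ 3 (*-mono-≤ 0<ρ 0<ρ)) 3ρ²≤0) λ ()
  T-bound-fibre ρ rough 0<ρ {v} {L@((.v , _) ∷ _)} distinct Splits@(s ∷ _) xs≡v@(refl ∷ _) 3ρ²≤L
    -- Drop the y congruent to one of the ρ multiples of v, at most ρ in number, so that the two
    -- families share no class.
    with avoid {X = λ p → Split p × proj₁ p ≡ v} (λ (_ , y) → y % m)
           proj₂ (applyUpTo (λ k → (k * v) % m) ρ)
           (fibre distinct xs≡v)
           (All.zip (Splits , xs≡v))
    where
    fibre : ∀ {L} → AllPairs _≁_ L → All (λ p → proj₁ p ≡ v) L →
            AllPairs (λ p q → p ≁ q × proj₂ p % m ≢ proj₂ q % m) L
    fibre [] [] = []
    fibre (r ∷ rs) (refl ∷ es) =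
      All.zipWith (λ { (p≁q , refl) → p≁q , p≁q ∘ +-cong-% m v }) (r , es) ∷ fibre rs es
  ... | L′ , distinct′ , Splits′ , avoids , len = *-cancelˡ-≤ 2 (begin
    2 * (ρ * c)                                       ≤⟨ *-monoʳ-≤ 2 multiples-bound ⟩
    2 * (Σks * m + ρ * (ρ * v))                       ≡⟨ regroup₁ Σks m ρ v ⟩
    -- The error 2 ρ² v is paid by the remaining y, at least 2 ρ² in number, each of which accounts
    -- for v.
    Σks * (2 * m) + 2 * (ρ * ρ) * v                   ≤⟨ +-monoʳ-≤ (Σks * (2 * m)) (≤-trans (*-monoˡ-≤ v 2ρ²≤L′) ys-bound) ⟩
    Σks * (2 * m) + Σys * (2 * m)                     ≡⟨ regroup₂ Σks Σys m ⟩
    2 * ((Σks + Σys) * m)                             ≤⟨ *-monoʳ-≤ 2 (*-monoˡ-≤ m total) ⟩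
    2 * (T * m)                                       ∎)
    where
    open ≤-Reasoning
    ks = applyUpTo (_* v) ρ
    ys = map proj₂ L′
    Σks = sum (map (hits m c) ks)
    Σys = sum (map (hits m c) ys)
    regroup₁ : ∀ a m ρ v → 2 * (a * m + ρ * (ρ * v)) ≡ a * (2 * m) + 2 * (ρ * ρ) * v
    regroup₁ = solve-∀
    regroup₂ : ∀ a b m → a * (2 * m) + b * (2 * m) ≡ 2 * ((a + b) * m)
    regroup₂ = solve-∀
    regroup₃ : ∀ r → 3 * r ≡ 2 * r + r
    regroup₃ = solve-∀
    2ρ²≤L′ : 2 * (ρ * ρ) ≤ length L′
    2ρ²≤L′ = +-cancelʳ-≤ (ρ * ρ) _ _ (begin
      2 * (ρ * ρ) + ρ * ρ  ≡⟨ regroup₃ (ρ * ρ) ⟨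
      3 * (ρ * ρ)          ≤⟨ 3ρ²≤L ⟩
      length L             ≤⟨ len ⟩
      length L′ + length (applyUpTo (λ k → (k * v) % m) ρ) ≡⟨ cong (length L′ +_) (length-applyUpTo _ ρ) ⟩
      -- Since ρ ≤ ρ², at least 3 ρ² - ρ² of the y remain.
      length L′ + ρ        ≤⟨ +-monoʳ-≤ (length L′) (m≤n*m ρ ρ {{>-nonZero 0<ρ}}) ⟩
      length L′ + ρ * ρ    ∎)
    multiples-bound : ρ * c ≤ Σks * m + ρ * (ρ * v)
    multiples-bound = subst (λ l → l * c ≤ Σks * m + l * (ρ * v)) (length-applyUpTo (_* v) ρ)
      (sum-bound (hits m c) c m (ρ * v) (All.applyUpTo⁺₁ (_* v) ρ λ {k} k<ρ →
        ≤-trans (hits-≥ m c (k * v)) (+-monoʳ-≤ (hits m c (k * v) * m) (*-monoˡ-≤ v (<⇒≤ k<ρ)))))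
    ys-bound : length L′ * v ≤ Σys * (2 * m)
    ys-bound = begin
      length L′ * v                        ≡⟨ cong (_* v) (length-map proj₂ L′) ⟨
      length ys * v                        ≤⟨ sum-bound (hits m c) v (2 * m) 0
        (All.map⁺ (All.map (λ { (s , refl) → ≤-trans (Split.hits-y s) (m≤m+n _ 0) }) Splits′)) ⟩
      Σys * (2 * m) + length ys * 0        ≡⟨ cong (Σys * (2 * m) +_) (*-zeroʳ (length ys)) ⟩
      Σys * (2 * m) + 0                    ≡⟨ +-identityʳ _ ⟩
      Σys * (2 * m)                        ∎
    ks-avoided : All (λ k → All (Incongruent m k) ys) ks
    ks-avoided = All.applyUpTo⁺₁ (_* v) ρ λ {k} k<ρ →
      All.map⁺ (All.map (λ ∉ks → ≢-sym (All.applyUpTo⁻ (λ k → (k * v) % m) ρ ∉ks k<ρ)) avoids)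
    total : Σks + Σys ≤ T
    total = begin
      Σks + Σys                                      ≡⟨ sum-++ (map (hits m c) ks) (map (hits m c) ys) ⟨
      sum (map (hits m c) ks ++ map (hits m c) ys)   ≡⟨ cong sum (map-++ (hits m c) ks ys) ⟨
      sum (map (hits m c) (ks ++ ys))                ≤⟨ hits-sum-≤
        (AllPairs.++⁺ (AllPairs.applyUpTo⁺₁ (_* v) ρ (multiples-incongruent m rough (Split.x%m≢0 s)))
                      (AllPairs.map⁺ (AllPairs.map proj₂ distinct′)) ks-avoided)
        (All.++⁺ (All.applyUpTo⁺₂ (_* v) ρ (P-* (proj₁ (Split.x-Apéry s))))
                 (All.map⁺ (All.map (proj₁ ∘ Split.y-Apéry ∘ proj₁) Splits′))) ⟩
      T                                              ∎

  -- Wilf's inequality in terms of c, d and T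

  wilf : ∀ ρ → 0 < ρ → m ≤ ρ * d → 60 * (ρ * (ρ * ρ)) ≤ m →
         (∀ p → Prime p → p ∣ m → ρ ≤ p) → c ≤ d * T
  wilf ρ 0<ρ m≤ρd N≤m rough with splits
  ... | L , distinct , Splits , m≤L+d with 4 * m ≤? 5 * d
  ...   | no 4m≰5d = *-cancelˡ-≤ ρ {{>-nonZero 0<ρ}} (begin
    ρ * c         ≤⟨ Sum.[ (λ (_ , xs , ss , len) → T-bound-summands ρ xs ss len)
                         , (λ (_ , _ , ps , ss , xs≡v , len) → T-bound-fibre ρ rough 0<ρ ps ss xs≡v len) ]
                       (pigeonhole proj₁ (4 * ρ) (3 * (ρ * ρ)) distinct Splits
                         (*-mono-≤ {1} {3} (s≤s z≤n) (*-mono-≤ 0<ρ 0<ρ)) many) ⟩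
    T * m         ≤⟨ *-monoʳ-≤ T m≤ρd ⟩
    T * (ρ * d)   ≡⟨ rotate T ρ d ⟩
    ρ * (d * T)   ∎)
    where
    open ≤-Reasoning
    rotate : ∀ t ρ d → t * (ρ * d) ≡ ρ * (d * t)
    rotate = solve-∀
    regroup₁ : ∀ ρ → 5 * (4 * ρ * (3 * (ρ * ρ))) ≡ 60 * (ρ * (ρ * ρ))
    regroup₁ = solve-∀
    regroup₂ : ∀ m → m + 4 * m ≡ 5 * m
    regroup₂ = solve-∀
    -- From 5 d < 4 m follows m ≤ 5 (m - d) ≤ 5 `length L`; the constant is 60 = 5 · 4 · 3, with 4 ρ
    -- and 3 ρ² required by the two outcomes of `pigeonhole`.
    many : 4 * ρ * (3 * (ρ * ρ)) ≤ length L
    many = *-cancelˡ-≤ 5 (begin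
      5 * (4 * ρ * (3 * (ρ * ρ))) ≡⟨ regroup₁ ρ ⟩
      60 * (ρ * (ρ * ρ))          ≤⟨ N≤m ⟩
      m                           ≤⟨ +-cancelʳ-≤ (4 * m) _ _ (begin
        m + 4 * m                   ≡⟨ regroup₂ m ⟩
        5 * m                       ≤⟨ *-monoʳ-≤ 5 m≤L+d ⟩
        5 * (length L + d)          ≡⟨ *-distribˡ-+ 5 (length L) d ⟩
        5 * length L + 5 * d        ≤⟨ +-monoʳ-≤ (5 * length L) (<⇒≤ (≰⇒> 4m≰5d)) ⟩
        5 * length L + 4 * m        ∎) ⟩
      5 * length L                ∎)
  ...   | yes 4m≤5d with L | Splits
  -- Without splits, `m≤L+d` reads m ≤ d.
  ...     | []    | _     = begin
    c      ≤⟨ T-bound-trivial ⟩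
    T * m  ≤⟨ *-monoʳ-≤ T m≤L+d ⟩
    T * d  ≡⟨ *-comm T d ⟩
    d * T  ∎
    where open ≤-Reasoning
  ...     | _ ∷ _ | s ∷ _ = *-cancelˡ-≤ 5 (begin
    5 * c         ≤⟨ T-bound-split s ⟩
    T * (4 * m)   ≤⟨ *-monoʳ-≤ T 4m≤5d ⟩
    T * (5 * d)   ≡⟨ rotate T d ⟩
    5 * (d * T)   ∎)
    where
    open ≤-Reasoning
    rotate : ∀ t d → t * (5 * d) ≡ 5 * (d * t)
    rotate = solve-∀

-- The semigroup generated by a vector

⟨⟩-+ : (a : Vector ℕ k) → ∀ {x y} → x ∈ ⟨ a ⟩ → y ∈ ⟨ a ⟩ → x + y ∈ ⟨ a ⟩
⟨⟩-+ {zero}  a (_ , refl) (_ , refl) = (λ ()) , refl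
⟨⟩-+ {suc k} a (b , refl) (c , refl) with ⟨⟩-+ (a ∘ suc) (b ∘ suc , refl) (c ∘ suc , refl)
... | d , eq = (b zero + c zero) ∷ᶠ d ,
  trans (regroup (b zero) (c zero) (a zero) _ _) (cong ((b zero + c zero) * a zero +_) eq)
  where
  regroup : ∀ b c a s t → (b * a + s) + (c * a + t) ≡ (b + c) * a + (s + t)
  regroup = solve-∀

generator∈ : (a : Vector ℕ k) → ∀ i → a i ∈ ⟨ a ⟩
generator∈ a zero with 0∈⟨ a ∘ suc ⟩
... | c , eq = 1 ∷ᶠ c , trans (sym (trans (+-identityʳ _) (+-identityʳ _))) (cong (a zero + 0 +_) eq)
generator∈ a (suc i) with generator∈ (a ∘ suc) i
... | c , eq = 0 ∷ᶠ c , eq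

-- Lower the first nonzero coefficient by one; `n ≢ 0` ensures that there is one.
∈⇒generator+ : (a : Vector ℕ k) → ∀ {n} → n ∈ ⟨ a ⟩ → n ≢ 0 → ∃₂ λ i y → n ≡ a i + y × y ∈ ⟨ a ⟩
∈⇒generator+ {zero}  a (_ , refl) n≢0 = contradiction refl n≢0
∈⇒generator+ {suc k} a {n} (c , n≡) n≢0 with c zero in c₀≡
... | suc q = zero , _ , trans n≡ (+-assoc (a zero) (q * a zero) _) , q ∷ᶠ (c ∘ suc) , refl
... | zero  with ∈⇒generator+ (a ∘ suc) (c ∘ suc , n≡) n≢0
...   | i , y , n≡a+y , b , y≡ = suc i , y , n≡a+y , 0 ∷ᶠ b , y≡

-- Gaps and nongaps of a numerical semigroup

module _ {e} (a : Vector ℕ (suc e)) (a>0 : ∀ i → 0 < a i) (a-mono : a Preserves Fin._<_ ⟶ _<_)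
         {F g} (frob : IsFrobenius ⟨ a ⟩ F) (genus : HasGenus ⟨ a ⟩ g) where

  private
    gap : Fin.Fin g → ℕ
    gap = proj₁ ∘ Inverse.to genus

  gap-injective : ∀ {i j} → gap i ≡ gap j → i ≡ j
  gap-injective {i} {j} eq = trans (sym (Inverse.strictlyInverseʳ genus i))
    (trans (cong (Inverse.from genus) (pair eq)) (Inverse.strictlyInverseʳ genus j))
    where
    pair : ∀ {x y : ∃ (∁ ⟨ a ⟩)} → proj₁ x ≡ proj₁ y → x ≡ y
    pair refl = refl

  -- The bijection enumerates the gaps, so a search through g indices decides whether n is one.
  ∉? : Decidable (_∉ ⟨ a ⟩)
  ∉? n with any? (λ i → gap i ≟ n)
  ... | yes (i , refl) = yes (proj₂ (Inverse.to genus i))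
  ... | no ¬gap = no λ n∉ → ¬gap (Inverse.from genus (n , n∉) ,
                                  cong proj₁ (Inverse.strictlyInverseˡ genus (n , n∉)))

  -- The bijection of HasGenus makes being a gap decidable, but not directly
  -- membership in ⟨ a ⟩; hence the counting is done with the double negation.
  NonGap : ℕ → Set
  NonGap n = ¬ (n ∉ ⟨ a ⟩)

  nonGap? : Decidable NonGap
  nonGap? n = ¬? (∉? n)

  nonGap-+ : ∀ {x y} → NonGap x → NonGap y → NonGap (x + y)
  nonGap-+ ¬¬x ¬¬y x+y∉ = ¬¬x λ x∈ → ¬¬y λ y∈ → x+y∉ (⟨⟩-+ a x∈ y∈)

  nonGap-large : ∀ {n} → suc F ≤ n → NonGap n
  nonGap-large F<n n∉ = <⇒≱ F<n (proj₂ frob _ n∉)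

  nonGap-generator : ∀ i → NonGap (a i)
  nonGap-generator i a∉ = a∉ (generator∈ a i)

  -- The conclusion is a finite search over decidable conditions, hence stable under double
  -- negation, so it may be proved as if `n ∈ ⟨ a ⟩` were given.
  nonGap⇒generator+ : ∀ {n} → NonGap n → n ≢ 0 → ∃ λ i → a i ≤ n × NonGap (n ∸ a i)
  nonGap⇒generator+ {n} ¬¬n n≢0 =
    decidable-stable (any? λ i → a i ≤? n ×-dec nonGap? (n ∸ a i)) λ ¬∃ →
    ¬¬n λ n∈ → let i , y , n≡a+y , y∈ = ∈⇒generator+ a n∈ n≢0 in
    ¬∃ (i , ≤-trans (m≤m+n (a i) y) (≤-reflexive (sym n≡a+y)) ,
        λ y∉ → y∉ (subst (_∈ ⟨ a ⟩) (sym (trans (cong (_∸ a i) n≡a+y) (m+n∸m≡n (a i) y))) y∈))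

  a₁≤ : ∀ i → a zero ≤ a i
  a₁≤ zero    = ≤-refl
  a₁≤ (suc i) = <⇒≤ (a-mono (s≤s z≤n))

  nonGap-least : ∀ {n} → NonGap n → n ≢ 0 → a zero ≤ n
  nonGap-least ¬¬n n≢0 with nonGap⇒generator+ ¬¬n n≢0
  ... | i , aᵢ≤n , _ = ≤-trans (a₁≤ i) aᵢ≤n

  -- Split off a generator a i; the remainder is nonzero since w differs from a i.
  decomposition : ∀ {w} → NonGap w → w ≢ 0 → All (w ≢_) (tabulate a) →
                  ∃₂ λ x y → w ≡ x + y × (NonGap x × x ≢ 0) × (NonGap y × y ≢ 0)
  decomposition {w} ¬¬w w≢0 w∉a with nonGap⇒generator+ ¬¬w w≢0
  ... | i , aᵢ≤w , ¬¬y = a i , w ∸ a i , sym (m+[n∸m]≡n aᵢ≤w) ,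
    (nonGap-generator i , m<n⇒n≢0 (a>0 i)) ,
    (¬¬y , λ w∸aᵢ≡0 → All.tabulate⁻ {f = a} w∉a i (≤-antisym (m∸n≡0⇒m≤n w∸aᵢ≡0) aᵢ≤w))

  -- The g gaps give disjoint singletons, and each counts 1 because gaps are at most F.
  genus≤gaps : g ≤ count ∉? (suc F)
  genus≤gaps = begin
    g                                                            ≡⟨ length-tabulate gap ⟨
    length gaps                                                  ≡⟨ *-identityʳ _ ⟨
    length gaps * 1                                              ≤⟨ sum-bound hit 1 1 0 (All.tabulate⁺ counted) ⟩
    sum (map hit gaps) * 1 + length gaps * 0                     ≡⟨ cong₂ _+_ (*-identityʳ _) (*-zeroʳ (length gaps)) ⟩
    sum (map hit gaps) + 0                                       ≡⟨ +-identityʳ _ ⟩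
    sum (map hit gaps)                                           ≤⟨ count-family (λ s j → j ≟ s) ∉? (suc F)
      (AllPairs.tabulate⁺ (λ { i≢j _ refl eq → i≢j (gap-injective eq) }))
      (All.tabulate⁺ (λ { i _ refl → proj₂ (Inverse.to genus i) })) ⟩
    count ∉? (suc F)                                             ∎
    where
    open ≤-Reasoning
    gaps = tabulate gap
    hit : ℕ → ℕ
    hit s = count (_≟ s) (suc F)
    counted : ∀ i → 1 ≤ hit (gap i) * 1 + 0
    counted i = ≤-trans (≤-<-trans z≤n (count-mono-< (_≟ gap i) refl (s≤s (proj₂ frob _ (proj₂ (Inverse.to genus i))))))
      (≤-reflexive (sym (trans (+-identityʳ _) (*-identityʳ _))))

  -- Gaps and nongaps in [0, F] are disjoint, so together they number at most F + 1.
  nonGaps≤ : count nonGap? (suc F) ≤ F + 1 ∸ g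
  nonGaps≤ = begin
    count nonGap? (suc F)             ≡⟨ m+n∸n≡m _ g ⟨
    count nonGap? (suc F) + g ∸ g     ≤⟨ ∸-monoˡ-≤ g (begin
      count nonGap? (suc F) + g                  ≤⟨ +-monoʳ-≤ _ genus≤gaps ⟩
      count nonGap? (suc F) + count ∉? (suc F)   ≤⟨ count-disjoint U? nonGap? ∉? _ _ (λ ¬¬n n∉ → ¬¬n n∉) (suc F) ⟩
      count U? (suc F)                           ≤⟨ count-≤ U? (suc F) ⟩
      suc F                                      ≡⟨ +-comm 1 F ⟩
      F + 1                                      ∎) ⟩
    F + 1 ∸ g                         ∎
    where open ≤-Reasoning

  wilf-inequality : ∀ ρ → 0 < ρ → a zero ≤ ρ * suc e → 60 * (ρ * (ρ * ρ)) ≤ a zero →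
                    (∀ p → Prime p → p ∣ a zero → ρ ≤ p) → F + 1 ≤ suc e * (F + 1 ∸ g)
  wilf-inequality ρ 0<ρ a₁≤ρd N≤a₁ rough = begin
    F + 1                           ≡⟨ +-comm F 1 ⟩
    suc F                           ≤⟨ subst (λ l → suc F ≤ suc l * count nonGap? (suc F)) length-G
      -- `a zero ∷ tabulate (a ∘ suc)` is `tabulate a` by definition, so `decomposition` has the
      -- form that `wilf` expects.
      (wilf nonGap? (λ 0∉ → 0∉ 0∈⟨ a ⟩) nonGap-+ (a zero) {{>-nonZero (a>0 zero)}} (nonGap-generator zero) nonGap-least
            (suc F) nonGap-large (tabulate (a ∘ suc)) decomposition ρ 0<ρ
            (subst (λ l → a zero ≤ ρ * suc l) (sym length-G) a₁≤ρd) N≤a₁ rough) ⟩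
    suc e * count nonGap? (suc F)   ≤⟨ *-monoʳ-≤ (suc e) nonGaps≤ ⟩
    suc e * (F + 1 ∸ g)             ∎
    where
    open ≤-Reasoning
    length-G : length (tabulate (a ∘ suc)) ≡ e
    length-G = length-tabulate (a ∘ suc)

-- Passage to ceilings and fractions

open import Data.Integer.Base as ℤ using (+_)
import Data.Integer.DivMod as ℤ
import Data.Integer.Properties as ℤ
open import Data.Rational.Unnormalised.Base using (_/_; _≥_; *≤*; ceiling)

-- The ceiling is the negative of the integer quotient q of - n by d = e + 1, and q d ≤ - n.
ceiling-/≤ : ∀ n e ρ → ceiling (+ n / suc e) ≡ + ρ → n ≤ ρ * suc e
ceiling-/≤ n e ρ eq = ℤ.drop‿+≤+ (begin
  + n                       ≡⟨ ℤ.neg-involutive (+ n) ⟨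
  ℤ.- (ℤ.- + n)             ≤⟨ ℤ.neg-mono-≤ (ℤ.[n/d]*d≤n (ℤ.- + n) (+ suc e)) ⟩
  ℤ.- (q ℤ.* + suc e)       ≡⟨ ℤ.neg-distribˡ-* q (+ suc e) ⟩
  ℤ.- q ℤ.* + suc e         ≡⟨ cong (ℤ._* + suc e) eq ⟩
  + ρ ℤ.* + suc e           ≡⟨ ℤ.pos-* ρ (suc e) ⟨
  + (ρ * suc e)             ∎)
  where
  open ℤ.≤-Reasoning
  q = (ℤ.- + n) ℤ./ + suc e

≥-/ : ∀ d n k .{{_ : NonZero k}} → n ≤ d * k → + d / 1 ≥ + n / k
≥-/ d n (suc k) n≤dk = *≤* (begin
  + n ℤ.* + 1       ≡⟨ ℤ.*-identityʳ (+ n) ⟩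
  + n               ≤⟨ ℤ.+≤+ n≤dk ⟩
  + (d * suc k)     ≡⟨ ℤ.pos-* d (suc k) ⟩
  + d ℤ.* + suc k   ∎)
  where open ℤ.≤-Reasoning

theorem1 : ∀ (ρ : ℕ) → 0 < ρ →
    ∃ λ (N : ℕ) → 2 ≤ N ×
    (∀ (e : ℕ) (let d = suc e) (a : Vector ℕ d) (let a₁ = a zero) →
    (∀ i → 0 < a i) →
    a Preserves Fin._<_ ⟶ _<_ →
    gcdAll a ≡ 1 →
    ceiling (+ a₁ / d) ≡ + ρ →
    ∀ (F g : ℕ) (frob : IsFrobenius ⟨ a ⟩ F) (genus : HasGenus ⟨ a ⟩ g) →
    N ≤ a₁ →
    (∀ p → Prime p → p ∣ a₁ → ρ ≤ p) →
    + d / 1 ≥ _/_ (+ (F + 1)) (F + 1 ∸ g) {{F+1∸g-nonZero a frob genus}})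
-- The threshold is the lower bound on m in `wilf`; it is at least 2 as ρ ≥ 1.
theorem1 ρ 0<ρ = 60 * (ρ * (ρ * ρ)) ,
  *-mono-≤ {2} {60} (s≤s (s≤s z≤n)) (*-mono-≤ 0<ρ (*-mono-≤ 0<ρ 0<ρ)) ,
  λ e a a>0 a-mono _ ⌈a₁/d⌉≡ρ F g frob genus N≤a₁ rough →
    ≥-/ (suc e) (F + 1) (F + 1 ∸ g) {{F+1∸g-nonZero a frob genus}}
      (wilf-inequality a a>0 a-mono frob genus ρ 0<ρ (ceiling-/≤ (a zero) e ρ ⌈a₁/d⌉≡ρ) N≤a₁ rough)
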